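{- Let $q$ be a prime power, let $1<k<n-1$, and let $V=F_q^n$. Let $U\subseteq V$ be a $(k+1)$-dimensional non-degenerate linear code, and let $\langle U]^c_k$ denote the set of all $k$-dimensional subspaces of $U$ that are non-degenerate linear codes. Then $\langle U]^c_k$ is a maximal clique of the graph $\Gamma(n,k)_q$ if and only if $\langle U]^c_k$ is not contained in a line of $\mathcal G_k(V)$.
   Context: $F_q$ is the field with $q$ elements; $\mathcal G_k(V)$ is the set of all $k$-dimensional subspaces of $V$. For $i=1,\dots,n$, $C_i=\{x\in V: x_i=0\}$ is the $i$-th coordinate hyperplane. A subspace of $V$ is a non-degenerate linear code if it is not contained in any $C_i$. $\Gamma(n,k)_q$ is the graph whose vertices are the $k$-dimensional non-degenerate linear codes in $V$, two distinct vertices being adjacent iff their intersection has dimension $k-1$. A clique is a set of pairwise adjacent vertices; it is maximal if not properly contained in another clique. A line of $\mathcal G_k(V)$ is a set $\{K\in\mathcal G_k(V): S\subset K\subset T\}$ with $S\subset T$ subspaces, $\dim S=k-1$, $\dim T=k+1$. -}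

module Defs where

open import Level using (0ℓ)
open import Data.Nat as ℕ using (ℕ; suc; _∸_; _^_)
open import Data.Nat.Primality using (Prime)
open import Data.Fin using (Fin; zero; suc)
open import Data.Product using (Σ; ∃; _×_; _,_)
open import Relation.Nullary using (¬_)
open import Relation.Binary.PropositionalEquality using (_≡_)
open import Algebra.Bundles using (CommutativeRing)

IsPrimePower : ℕ → Set
IsPrimePower q = Σ ℕ λ p → Σ ℕ λ e → Prime p × q ≡ p ^ suc e

record FiniteField (q : ℕ) : Set₁ where
  field
    cring : CommutativeRing 0ℓ 0ℓ
  open CommutativeRing cring public
  field
    1≉0       : ¬ (1# ≈ 0#)
    inverse   : ∀ x → ¬ (x ≈ 0#) → Σ Carrier λ y → x * y ≈ 1#
    enum      : Fin q → Carrier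
    enum-inj  : ∀ i j → enum i ≈ enum j → i ≡ j
    enum-surj : ∀ x → Σ (Fin q) λ i → enum i ≈ x

module Codes {q : ℕ} (F : FiniteField q) (n : ℕ) where
  open FiniteField F using (Carrier; _≈_; _+_; _*_; 0#)

  V : Set
  V = Fin n → Carrier

  _≈ᵥ_ : V → V → Set
  x ≈ᵥ y = ∀ i → x i ≈ y i

  0ᵥ : V
  0ᵥ _ = 0#

  _+ᵥ_ : V → V → V
  (x +ᵥ y) i = x i + y i

  _·_ : Carrier → V → V
  (a · x) i = a * x i

  lincomb : ∀ {m} → (Fin m → Carrier) → (Fin m → V) → V
  lincomb {ℕ.zero} c b = 0ᵥ
  lincomb {suc m} c b = (c zero · b zero) +ᵥ lincomb (λ i → c (suc i)) (λ i → b (suc i))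

  SubsetV : Set₁
  SubsetV = V → Set

  _⊆_ : SubsetV → SubsetV → Set
  S ⊆ T = ∀ x → S x → T x

  _∩_ : SubsetV → SubsetV → SubsetV
  (S ∩ T) x = S x × T x

  SameSet : SubsetV → SubsetV → Set
  SameSet S T = S ⊆ T × T ⊆ S

  record IsSubspace (S : SubsetV) : Set where
    field
      resp  : ∀ {x y} → x ≈ᵥ y → S x → S y
      zero∈ : S 0ᵥ
      +-cl  : ∀ {x y} → S x → S y → S (x +ᵥ y)
      ·-cl  : ∀ a {x} → S x → S (a · x)

  LinIndep : ∀ {m} → (Fin m → V) → Set
  LinIndep {m} b = ∀ (c : Fin m → Carrier) → lincomb c b ≈ᵥ 0ᵥ → ∀ i → c i ≈ 0#

  Spans : ∀ {m} → (Fin m → V) → SubsetV → Set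
  Spans {m} b S = ∀ x → S x → Σ (Fin m → Carrier) λ c → x ≈ᵥ lincomb c b

  -- S (assumed a subspace) has dimension k: it has a basis of k vectors
  HasDim : SubsetV → ℕ → Set
  HasDim S k = Σ (Fin k → V) λ b → (∀ i → S (b i)) × LinIndep b × Spans b S

  Subspace : ℕ → SubsetV → Set
  Subspace k S = IsSubspace S × HasDim S k

  C : Fin n → SubsetV
  C i x = x i ≈ 0#

  NonDegenerate : SubsetV → Set
  NonDegenerate S = ∀ i → ¬ (S ⊆ C i)

  Vertex : ℕ → SubsetV → Set
  Vertex k S = Subspace k S × NonDegenerate S

  Adjacent : ℕ → SubsetV → SubsetV → Set
  Adjacent k S T = ¬ SameSet S T × HasDim (S ∩ T) (k ∸ 1)

  Family : Set₂
  Family = SubsetV → Set₁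

  IsClique : ℕ → Family → Set₁
  IsClique k 𝒞 = (∀ S → 𝒞 S → Vertex k S)
               × (∀ S T → 𝒞 S → 𝒞 T → ¬ SameSet S T → Adjacent k S T)

  IsMaximalClique : ℕ → Family → Set₂
  IsMaximalClique k 𝒞 = IsClique k 𝒞
    × (∀ (𝒟 : Family) → IsClique k 𝒟 → (∀ S → 𝒞 S → 𝒟 S) → ∀ S → 𝒟 S → 𝒞 S)

  CodesIn : ℕ → SubsetV → Family
  CodesIn k U S = Lift-⊆ (S ⊆ U × Vertex k S)
    where
      Lift-⊆ : Set → Set₁
      Lift-⊆ A = Level.Lift _ A

  InLine : ℕ → SubsetV → SubsetV → SubsetV → Set
  InLine k S T K = Subspace k K × S ⊆ K × K ⊆ T

  ContainedInLine : ℕ → Family → Set₁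
  ContainedInLine k 𝒞 = Σ SubsetV λ S → Σ SubsetV λ T →
    Subspace (k ∸ 1) S × Subspace (suc k) T × S ⊆ T × (∀ K → 𝒞 K → InLine k S T K)

module Submission where

-- All of linear algebra rests on one fact: m independent vectors of an
-- m-dimensional space over a finite field span it.
--
-- If the clique is not maximal, some K not inside U meets every member M, and
-- every M ∩ K equals the same (k-1)-space S, so all members lie on the line (S, U);
-- without members, any (k-1)-space S inside U will do.
--
-- Conversely let every member contain the (k-1)-space S of U, and pick y ≠ 0 in S and a
-- basis y, v₀, v₁, … of U. Every hyperplane of U missing y is degenerate, i.e. the
-- kernel of a coordinate function x ↦ xᵢ on U with yᵢ ≠ 0. Let y*, v₀*, v₁* be the
-- dual functionals. The kernels of y*, y* - v₀*, y* - v₁*, y* - v₀* - v₁* give such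
-- indices, the first of which, p, differs from the other three; since
-- y* = (y* - v₀*) + (y* - v₁*) - (y* - v₀* - v₁*), the unit vector e_p is not in U.
-- Hence one of (1,…,1) and (1,…,1) + e_p is a vector x outside U, and S + ⟨x⟩ is
-- non-degenerate because y_p ≠ 0 (it enlarges the clique, meeting each member in S).

open import Defs
open import Data.Nat using (ℕ; zero; suc; _+_; _^_; _<_; z≤n; s≤s)
open import Data.Nat.Properties using (1+n≰n)
open import Data.Fin using (Fin; zero; suc; punchIn; punchOut; combine; finToFun; funToFin)
open import Data.Fin.Properties
  using (all?; any?; _≟_; punchOut-injective; injective⇒≤; funToFin-finToFin; finToFun-funToFin)
open import Data.Vec.Functional using (_∷_; tail)
open import Data.Product using (Σ; ∃; _×_; _,_; proj₁; proj₂)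
open import Data.Sum using (_⊎_; inj₁; inj₂)
open import Data.Empty using (⊥)
open import Level using (lift; lower)
open import Relation.Nullary using (¬_; Dec; yes; no; contradiction)
open import Relation.Nullary.Decidable using (map′; ¬?; decidable-stable)
open import Relation.Nullary.Negation using (¬∃⟶∀¬)
open import Relation.Binary.PropositionalEquality as ≡ using (_≡_; _≢_; _≗_)
open import Function using (_∘_)
open import Function.Definitions using (Injective)
open import Function.Bundles using (_⇔_; mk⇔)

-- Finite sets: the pigeonhole principle and codes for functions.

-- A missed value could be punched out of the codomain, leaving an injection into a smaller finite
-- set.
injective⇒surjective : ∀ {m} {f : Fin m → Fin m} → Injective _≡_ _≡_ f →
  ∀ y → ∃ λ x → f x ≡ y
injective⇒surjective {suc m} {f} inj y with any? (λ x → f x ≟ y)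
... | yes hit  = hit
... | no  miss = contradiction (injective⇒≤ punched-injective) 1+n≰n
  where
  avoids : ∀ x → y ≢ f x
  avoids x eq = miss (x , ≡.sym eq)
  punched-injective : Injective _≡_ _≡_ (λ x → punchOut (avoids x))
  punched-injective {x} {x′} eq = inj (punchOut-injective (avoids x) (avoids x′) eq)

funToFin-cong : ∀ {m q} {f g : Fin m → Fin q} → f ≗ g → funToFin f ≡ funToFin g
funToFin-cong {zero}  f≗g = ≡.refl
funToFin-cong {suc m} f≗g =
  ≡.cong₂ combine (f≗g zero) (funToFin-cong (f≗g ∘ suc))

module LinearAlgebra {q : ℕ} (F : FiniteField q) (n : ℕ) where
  open FiniteField F hiding (_+_; zero)
  open FiniteField F using () renaming (_+_ to _⊕_)
  open Codes F n
  open IsSubspace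
  open import Algebra.Properties.Ring ring using (-1*x≈-x)
  open import Algebra.Properties.AbelianGroup +-abelianGroup using (xyx⁻¹≈y)
  open import Algebra.Solver.Ring.NaturalCoefficients.Default commutativeSemiring
    using (solve; _:+_; _:*_; _:=_)
  open import Relation.Binary.Reasoning.Setoid setoid

  -- Arithmetic and decidable equality in the finite field.

  _≈?_ : ∀ x y → Dec (x ≈ y)
  x ≈? y with enum-surj x | enum-surj y
  ... | i , i≈x | j , j≈y = map′
    (λ { ≡.refl → trans (sym i≈x) j≈y })
    (λ x≈y → enum-inj i j (trans i≈x (trans x≈y (sym j≈y))))
    (i ≟ j)

  index : Carrier → Fin q
  index x = proj₁ (enum-surj x)

  enum-index : ∀ x → enum (index x) ≈ x
  enum-index x = proj₂ (enum-surj x)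

  x+-1*x≈0 : ∀ x → x ⊕ - 1# * x ≈ 0#
  x+-1*x≈0 x = trans (+-congˡ (-1*x≈-x x)) (-‿inverseʳ x)

  [x+y]+-1*y≈x : ∀ x y → (x ⊕ y) ⊕ - 1# * y ≈ x
  [x+y]+-1*y≈x x y = trans (+-assoc x y _) (trans (+-congˡ (x+-1*x≈0 y)) (+-identityʳ x))

  x+-1*y≈0⇒x≈y : ∀ {x y} → x ⊕ - 1# * y ≈ 0# → x ≈ y
  x+-1*y≈0⇒x≈y {x} {y} eq = begin
    x                          ≈⟨ [x+y]+-1*y≈x x y ⟨
    (x ⊕ y) ⊕ - 1# * y         ≈⟨ solve 3 (λ x y z → (x :+ y) :+ z := (x :+ z) :+ y) refl x y _ ⟩
    (x ⊕ - 1# * y) ⊕ y         ≈⟨ +-congʳ eq ⟩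
    0# ⊕ y                     ≈⟨ +-identityˡ y ⟩
    y                          ∎

  *-cancelʳ : ∀ {x y z} → ¬ (z ≈ 0#) → x * z ≈ y * z → x ≈ y
  *-cancelʳ {x} {y} {z} z≉0 eq with inverse z z≉0
  ... | w , zw≈1 = begin
    x            ≈⟨ *-identityʳ x ⟨
    x * 1#       ≈⟨ *-congˡ zw≈1 ⟨
    x * (z * w)  ≈⟨ *-assoc x z w ⟨
    (x * z) * w  ≈⟨ *-congʳ eq ⟩
    (y * z) * w  ≈⟨ *-assoc y z w ⟩
    y * (z * w)  ≈⟨ *-congˡ zw≈1 ⟩
    y * 1#       ≈⟨ *-identityʳ y ⟩
    y            ∎

  private variable
    m d : ℕ
    P S U M N : SubsetV

  -- Linear combinations.

  lincomb-cong : {c c′ : Fin m → Carrier} (b : Fin m → V) →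
    (∀ i → c i ≈ c′ i) → lincomb c b ≈ᵥ lincomb c′ b
  lincomb-cong {zero}  b eq i = refl
  lincomb-cong {suc m} b eq i = +-cong (*-congʳ (eq zero)) (lincomb-cong (b ∘ suc) (eq ∘ suc) i)

  lincomb-0 : {c : Fin m → Carrier} (b : Fin m → V) → (∀ i → c i ≈ 0#) → lincomb c b ≈ᵥ 0ᵥ
  lincomb-0 {zero}  b eq i = refl
  lincomb-0 {suc m} b eq i = trans
    (+-cong (trans (*-congʳ (eq zero)) (zeroˡ _)) (lincomb-0 (b ∘ suc) (eq ∘ suc) i))
    (+-identityˡ 0#)

  lincomb-+ : (c c′ : Fin m → Carrier) (b : Fin m → V) →
    (lincomb c b +ᵥ lincomb c′ b) ≈ᵥ lincomb (λ i → c i ⊕ c′ i) b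
  lincomb-+ {zero}  c c′ b i = +-identityˡ 0#
  lincomb-+ {suc m} c c′ b i = trans
    (solve 5 (λ s t x l l′ → (s :* x :+ l) :+ (t :* x :+ l′) := (s :+ t) :* x :+ (l :+ l′))
      refl (c zero) (c′ zero) (b zero i) _ _)
    (+-congˡ (lincomb-+ (c ∘ suc) (c′ ∘ suc) (b ∘ suc) i))

  lincomb-· : (a : Carrier) (c : Fin m → Carrier) (b : Fin m → V) →
    (a · lincomb c b) ≈ᵥ lincomb (λ i → a * c i) b
  lincomb-· {zero}  a c b i = zeroʳ a
  lincomb-· {suc m} a c b i = trans
    (solve 4 (λ a s x l → a :* (s :* x :+ l) := (a :* s) :* x :+ a :* l) refl a (c zero) (b zero i) _)
    (+-congˡ (lincomb-· a (c ∘ suc) (b ∘ suc) i))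

  lincomb-∈ : IsSubspace P → (c : Fin m → Carrier) {b : Fin m → V} →
    (∀ i → P (b i)) → P (lincomb c b)
  lincomb-∈ {m = zero}  P-sub c b∈ = zero∈ P-sub
  lincomb-∈ {m = suc m} P-sub c b∈ =
    +-cl P-sub (·-cl P-sub (c zero) (b∈ zero)) (lincomb-∈ P-sub (c ∘ suc) (b∈ ∘ suc))

  lincomb-punchIn : (c : Fin (suc m) → Carrier) (b : Fin (suc m) → V) (j : Fin (suc m)) →
    lincomb c b ≈ᵥ ((c j · b j) +ᵥ lincomb (c ∘ punchIn j) (b ∘ punchIn j))
  lincomb-punchIn         c b zero    i = refl
  lincomb-punchIn {suc m} c b (suc j) i = trans
    (+-congˡ (lincomb-punchIn (c ∘ suc) (b ∘ suc) j i))
    (solve 3 (λ x y z → x :+ (y :+ z) := y :+ (x :+ z)) refl _ _ _)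

  -- Subspaces and spans.

  C-subspace : ∀ i → IsSubspace (C i)
  C-subspace i = record
    { resp  = λ x≈y x∈ → trans (sym (x≈y i)) x∈
    ; zero∈ = refl
    ; +-cl  = λ x∈ y∈ → trans (+-cong x∈ y∈) (+-identityˡ 0#)
    ; ·-cl  = λ a x∈ → trans (*-congˡ x∈) (zeroʳ a)
    }

  ∩-subspace : IsSubspace S → IsSubspace P → IsSubspace (S ∩ P)
  ∩-subspace S-sub P-sub = record
    { resp  = λ x≈y (x∈S , x∈P) → resp S-sub x≈y x∈S , resp P-sub x≈y x∈P
    ; zero∈ = zero∈ S-sub , zero∈ P-sub
    ; +-cl  = λ (x∈S , x∈P) (y∈S , y∈P) → +-cl S-sub x∈S y∈S , +-cl P-sub x∈P y∈P
    ; ·-cl  = λ a (x∈S , x∈P) → ·-cl S-sub a x∈S , ·-cl P-sub a x∈P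
    }

  Span : (Fin m → V) → SubsetV
  Span {m} b x = Σ (Fin m → Carrier) λ c → x ≈ᵥ lincomb c b

  span-subspace : (b : Fin m → V) → IsSubspace (Span b)
  span-subspace b = record
    { resp  = λ x≈y (c , x≈) → c , λ i → trans (sym (x≈y i)) (x≈ i)
    ; zero∈ = (λ _ → 0#) , λ i → sym (lincomb-0 b (λ _ → refl) i)
    ; +-cl  = λ (c , x≈) (c′ , y≈) → _ , λ i → trans (+-cong (x≈ i) (y≈ i)) (lincomb-+ c c′ b i)
    ; ·-cl  = λ a (c , x≈) → _ , λ i → trans (*-congˡ (x≈ i)) (lincomb-· a c b i)
    }

  ∈-span : (b : Fin m → V) → ∀ j → Span b (b j)
  ∈-span b zero = (1# ∷ λ _ → 0#) , λ i → sym (trans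
    (+-cong (*-identityˡ _) (lincomb-0 (b ∘ suc) (λ _ → refl) i)) (+-identityʳ _))
  ∈-span b (suc j) with ∈-span (b ∘ suc) j
  ... | c , eq = (0# ∷ c) , λ i → sym (trans
    (+-cong (zeroˡ _) (sym (eq i))) (+-identityˡ _))

  -- Linear independence.

  -- Otherwise subtracting `p` and dividing by `c` would put `x` into `P`. This is the standard way
  -- below to show that a coefficient vanishes.
  ·-cancel-∈ : IsSubspace P → {x p : V} {c : Carrier} →
    ¬ P x → P p → P ((c · x) +ᵥ p) → c ≈ 0#
  ·-cancel-∈ {P} P-sub {x} {p} {c} x∉ p∈ cx+p∈ with c ≈? 0#
  ... | yes c≈0 = c≈0
  ... | no  c≉0 with inverse c c≉0
  ...   | z , cz≈1 = contradiction (resp P-sub z[cx]≈x (·-cl P-sub z cx∈)) x∉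
    where
    cx∈ : P (c · x)
    cx∈ = resp P-sub (λ i → [x+y]+-1*y≈x _ _) (+-cl P-sub cx+p∈ (·-cl P-sub (- 1#) p∈))
    z[cx]≈x : (z · (c · x)) ≈ᵥ x
    z[cx]≈x i = begin
      z * (c * x i)  ≈⟨ solve 3 (λ z c x → z :* (c :* x) := (c :* z) :* x) refl z c (x i) ⟩
      (c * z) * x i  ≈⟨ *-congʳ cz≈1 ⟩
      1# * x i       ≈⟨ *-identityˡ (x i) ⟩
      x i            ∎

  indep-unique : (b : Fin m → V) → LinIndep b → (c c′ : Fin m → Carrier) →
    lincomb c b ≈ᵥ lincomb c′ b → ∀ i → c i ≈ c′ i
  indep-unique b b-ind c c′ eq j = x+-1*y≈0⇒x≈y (b-ind _ difference j)
    where
    difference : lincomb (λ i → c i ⊕ - 1# * c′ i) b ≈ᵥ 0ᵥ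
    difference i = begin
      lincomb (λ i → c i ⊕ - 1# * c′ i) b i           ≈⟨ lincomb-+ c _ b i ⟨
      lincomb c b i ⊕ lincomb (λ i → - 1# * c′ i) b i  ≈⟨ +-cong (eq i) (sym (lincomb-· (- 1#) c′ b i)) ⟩
      lincomb c′ b i ⊕ - 1# * lincomb c′ b i           ≈⟨ x+-1*x≈0 _ ⟩
      0#                                               ∎

  indep-∷ : (x : V) (b : Fin m → V) → ¬ Span b x → LinIndep b → LinIndep (x ∷ b)
  indep-∷ x b x∉ b-ind c eq = λ { zero → c₀≈0 ; (suc i) → b-ind (c ∘ suc) rest≈0 i }
    where
    b-sub = span-subspace b
    c₀≈0 : c zero ≈ 0#
    c₀≈0 = ·-cancel-∈ b-sub x∉ (c ∘ suc , λ _ → refl)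
      (resp b-sub (λ i → sym (eq i)) (zero∈ b-sub))
    rest≈0 : lincomb (c ∘ suc) b ≈ᵥ 0ᵥ
    rest≈0 i = begin
      lincomb (c ∘ suc) b i                 ≈⟨ +-identityˡ _ ⟨
      0# ⊕ lincomb (c ∘ suc) b i            ≈⟨ +-congʳ (trans (*-congʳ c₀≈0) (zeroˡ _)) ⟨
      c zero * x i ⊕ lincomb (c ∘ suc) b i  ≈⟨ eq i ⟩
      0#                                    ∎

  indep-tail : (b : Fin (suc m) → V) → LinIndep b → LinIndep (tail b)
  indep-tail b b-ind c eq i = b-ind (0# ∷ c)
    (λ i → trans (+-cong (zeroˡ _) (eq i)) (+-identityˡ 0#)) (suc i)

  indep-head∉span-tail : (b : Fin (suc m) → V) → LinIndep b → ¬ Span (tail b) (b zero)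
  indep-head∉span-tail b b-ind (c , eq) =
    1≉0 (indep-unique b b-ind (1# ∷ λ _ → 0#) (0# ∷ c) same zero)
    where
    same : lincomb (1# ∷ λ _ → 0#) b ≈ᵥ lincomb (0# ∷ c) b
    same i = begin
      1# * b zero i ⊕ lincomb (λ _ → 0#) (tail b) i  ≈⟨ +-cong (*-identityˡ _) (lincomb-0 (tail b) (λ _ → refl) i) ⟩
      b zero i ⊕ 0#                                  ≈⟨ +-comm _ _ ⟩
      0# ⊕ b zero i                                  ≈⟨ +-cong (sym (zeroˡ _)) (eq i) ⟩
      0# * b zero i ⊕ lincomb c (tail b) i           ∎

  -- A relation for the reordered family becomes one for `b` once its leading coefficient is
  -- inserted at position `j`.
  indep-punchIn : (b : Fin (suc m) → V) (j : Fin (suc m)) →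
    LinIndep b → LinIndep (b j ∷ (b ∘ punchIn j))
  indep-punchIn {m} b j b-ind c eq = λ
    { zero    → trans (reflexive (≡.sym at-j)) (b-ind c′ eq′ j)
    ; (suc i) → trans (reflexive (≡.sym (at-punchIn i))) (b-ind c′ eq′ (punchIn j i))
    }
    where
    open import Data.Vec.Functional using (insertAt)
    open import Data.Vec.Functional.Properties using (insertAt-lookup; insertAt-punchIn)
    c′ = insertAt (tail c) j (c zero)
    at-j : c′ j ≡ c zero
    at-j = insertAt-lookup (tail c) j (c zero)
    at-punchIn : ∀ i → c′ (punchIn j i) ≡ c (suc i)
    at-punchIn i = insertAt-punchIn (tail c) j (c zero) i
    eq′ : lincomb c′ b ≈ᵥ 0ᵥ
    eq′ i = trans (lincomb-punchIn c′ b j i) (trans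
      (+-cong (*-congʳ (reflexive at-j)) (lincomb-cong (b ∘ punchIn j) (λ i → reflexive (at-punchIn i)) i))
      (eq i))

  -- Dimension and decidable membership.

  -- Coordinates of lincomb c v in the basis b give an injective, hence
  -- surjective, self-map of the finite set of coefficient vectors c.
  indep-spans : HasDim S m → IsSubspace S → (v : Fin m → V) →
    LinIndep v → (∀ i → S (v i)) → Spans v S
  indep-spans {S} {m} (b , b∈ , b-ind , b-span) S-sub v v-ind v∈ x x∈ =
    let d , x≈ = b-span x x∈
        j , j↦ = injective⇒surjective coords-injective (funToFin (index ∘ d))
    in coeffs j , λ i → trans (x≈ i) (trans
         (lincomb-cong b (λ l → sym (funToFin-index-injective (coord (coeffs j)) d j↦ l)) i)
         (sym (proj₂ (b-span _ (lincomb-∈ S-sub (coeffs j) v∈)) i)))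
    where
    coeffs : Fin (q ^ m) → Fin m → Carrier
    coeffs j = enum ∘ finToFun j
    coord : (Fin m → Carrier) → Fin m → Carrier
    coord c = proj₁ (b-span (lincomb c v) (lincomb-∈ S-sub c v∈))
    coord-≈ : ∀ c → lincomb c v ≈ᵥ lincomb (coord c) b
    coord-≈ c = proj₂ (b-span (lincomb c v) (lincomb-∈ S-sub c v∈))
    funToFin-index-injective : (c c′ : Fin m → Carrier) →
      funToFin (index ∘ c) ≡ funToFin (index ∘ c′) → ∀ l → c l ≈ c′ l
    funToFin-index-injective c c′ eq l = begin
      c l              ≈⟨ enum-index (c l) ⟨
      enum (index (c l))   ≡⟨ ≡.cong enum (≡.trans (≡.sym (finToFun-funToFin (index ∘ c) l))
                             (≡.trans (≡.cong (λ z → finToFun z l) eq) (finToFun-funToFin (index ∘ c′) l))) ⟩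
      enum (index (c′ l))  ≈⟨ enum-index (c′ l) ⟩
      c′ l             ∎
    coords-injective : Injective _≡_ _≡_ (λ j → funToFin (index ∘ coord (coeffs j)))
    coords-injective {j} {j′} eq = ≡.trans (≡.sym (funToFin-finToFin {m} j))
      (≡.trans (funToFin-cong same) (funToFin-finToFin {m} j′))
      where
      same : finToFun {q} {m} j ≗ finToFun j′
      same l = enum-inj _ _ (indep-unique v v-ind (coeffs j) (coeffs j′)
        (λ i → trans (coord-≈ (coeffs j) i) (trans
          (lincomb-cong b (funToFin-index-injective (coord (coeffs j)) (coord (coeffs j′)) eq) i)
          (sym (coord-≈ (coeffs j′) i)))) l)

  -- There are only `q ^ m` coefficient vectors to try. Through `member?` this makes the later case
  -- splits and double-negation eliminations constructive.
  _∈span?_ : ∀ x (b : Fin m → V) → Dec (Span b x)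
  _∈span?_ {m} x b = map′
    (λ (j , eq) → _ , eq)
    (λ (c , eq) → funToFin (index ∘ c) , λ i → trans (eq i) (lincomb-cong b (λ l → sym (trans
      (reflexive (≡.cong enum (finToFun-funToFin (index ∘ c) l))) (enum-index (c l)))) i))
    (any? {q ^ m} λ j → all? λ i → x i ≈? lincomb (enum ∘ finToFun j) b i)

  member? : Subspace d S → ∀ x → Dec (S x)
  member? (S-sub , b , b∈ , _ , b-span) x = map′
    (λ (c , eq) → resp S-sub (λ i → sym (eq i)) (lincomb-∈ S-sub c b∈))
    (b-span x)
    (x ∈span? b)

  spans-⊆ : (b : Fin m → V) → Spans b S → IsSubspace P → (∀ i → P (b i)) → S ⊆ P
  spans-⊆ b b-span P-sub b∈ x x∈ = let c , eq = b-span x x∈ in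
    resp P-sub (λ i → sym (eq i)) (lincomb-∈ P-sub c b∈)

  span-⊆ : (b : Fin m → V) → IsSubspace P → (∀ i → P (b i)) → Span b ⊆ P
  span-⊆ b P-sub b∈ = spans-⊆ b (λ _ x∈ → x∈) P-sub b∈

  span-Subspace : (b : Fin m → V) → LinIndep b → Subspace m (Span b)
  span-Subspace b b-ind = span-subspace b , b , ∈-span b , b-ind , λ _ x∈ → x∈

  -- Exchange, shears and intersections of hyperplanes.

  -- Steinitz exchange: some coefficient `c j` of `y` is nonzero, so `y` can replace `b j`; were `y`
  -- in the span of the others, `c j` would vanish.
  exchange : Subspace (suc m) M → ∀ {y} → M y → ¬ (y ≈ᵥ 0ᵥ) →
    Σ (Fin m → V) λ v → (∀ i → M (v i)) × LinIndep (y ∷ v)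
  exchange (M-sub , b , b∈ , b-ind , b-span) {y} y∈ y≉0
    with b-span y y∈
  ... | c , y≈ with any? (λ j → ¬? (c j ≈? 0#))
  ...   | no  none = contradiction
    (λ i → trans (y≈ i) (lincomb-0 b (λ j → decidable-stable (c j ≈? 0#) (¬∃⟶∀¬ none j)) i)) y≉0
  ...   | yes (j , cⱼ≉0) = v , b∈ ∘ punchIn j , indep-∷ y v y∉ (indep-tail (b j ∷ v) front)
    where
    v = b ∘ punchIn j
    front = indep-punchIn b j b-ind
    y∉ : ¬ Span v y
    y∉ y∈v = cⱼ≉0 (·-cancel-∈ (span-subspace v) (indep-head∉span-tail (b j ∷ v) front)
      (c ∘ punchIn j , λ _ → refl)
      (resp (span-subspace v) (λ i → trans (y≈ i) (lincomb-punchIn c b j i)) y∈v))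

  -- When `y ∷ v` is a basis, the sheared vectors span the kernel of y* minus the sum of the `t j`
  -- times the dual functionals of the `v j`. These kernels are the hyperplanes that miss `y`.
  shear : V → (Fin m → Carrier) → (Fin m → V) → Fin m → V
  shear y t v j = v j +ᵥ (t j · y)

  lincomb-shear : (y : V) (t c : Fin m → Carrier) (v : Fin m → V) →
    Σ Carrier λ e → lincomb c (shear y t v) ≈ᵥ ((e · y) +ᵥ lincomb c v)
  lincomb-shear {zero}  y t c v = 0# , λ i → sym (trans (+-identityʳ _) (zeroˡ _))
  lincomb-shear {suc m} y t c v =
    let e , eq = lincomb-shear y (tail t) (tail c) (tail v) in
    c zero * t zero ⊕ e , λ i → trans (+-congˡ (eq i))
      (solve 6 (λ c t e y v l → c :* (v :+ t :* y) :+ (e :* y :+ l)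
                              := (c :* t :+ e) :* y :+ (c :* v :+ l))
        refl (c zero) (t zero) e (y i) (v zero i) _)

  -- By `lincomb-shear`, a relation here is one among `y ∷ v` with only the coefficient of `y`
  -- changed, so the other coefficients vanish. Then the shear has no effect, and the coefficient of
  -- `y` vanishes too.
  shear-indep : (y : V) (v : Fin m → V) (t : Fin m → Carrier) →
    LinIndep (y ∷ v) → LinIndep (y ∷ shear y t v)
  shear-indep y v t yv-ind c eq = λ { zero → c₀≈0 ; (suc j) → cₛ≈0 j }
    where
    e = proj₁ (lincomb-shear y t (tail c) v)
    e-eq = proj₂ (lincomb-shear y t (tail c) v)
    cₛ≈0 : ∀ j → c (suc j) ≈ 0#
    cₛ≈0 j = yv-ind ((c zero ⊕ e) ∷ tail c) (λ i → trans
      (trans (solve 4 (λ c e y l → (c :+ e) :* y :+ l := c :* y :+ (e :* y :+ l))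
               refl (c zero) e (y i) _)
             (+-congˡ (sym (e-eq i))))
      (eq i)) (suc j)
    c₀≈0 : c zero ≈ 0#
    c₀≈0 = yv-ind c (λ i → trans
      (+-congˡ (trans (lincomb-0 v cₛ≈0 i) (sym (lincomb-0 (shear y t v) cₛ≈0 i))))
      (eq i)) zero

  -- A basis y ∷ v of M with y ∉ N is sheared along y into N: every v j is
  -- congruent modulo N to a multiple of y, as N and y together span U.
  meet-dim : Subspace (suc (suc m)) U → Subspace (suc m) M → Subspace (suc m) N →
    M ⊆ U → N ⊆ U → ¬ M ⊆ N → HasDim (M ∩ N) m
  meet-dim {m} {U} {M} {N} (U-sub , U-dim) M-dim@(M-sub , b , b∈ , b-ind , b-span)
           N-dim@(N-sub , d , d∈ , d-ind , d-span) M⊆U N⊆U M⊈N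
    with any? (λ j → ¬? (member? N-dim (b j)))
  ... | no  none = contradiction
    (spans-⊆ b b-span N-sub λ j → decidable-stable (member? N-dim (b j)) (¬∃⟶∀¬ none j)) M⊈N
  ... | yes (j , y∉N) = w , (λ l → w∈M l , w∈N l) , indep-tail (y ∷ w) yw-ind , spans
    where
    y = b j
    y≉0 : ¬ (y ≈ᵥ 0ᵥ)
    y≉0 y≈0 = y∉N (resp N-sub (λ i → sym (y≈0 i)) (zero∈ N-sub))
    basis = exchange M-dim (b∈ j) y≉0
    v = proj₁ basis
    v∈M = proj₁ (proj₂ basis)
    yd-span : Spans (y ∷ d) U
    yd-span = indep-spans U-dim U-sub (y ∷ d)
      (indep-∷ y d (λ y∈ → y∉N (span-⊆ d N-sub d∈ y y∈)) d-ind)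
      λ { zero → M⊆U y (b∈ j) ; (suc l) → N⊆U (d l) (d∈ l) }
    coords : ∀ l → Span (y ∷ d) (v l)
    coords l = yd-span (v l) (M⊆U (v l) (v∈M l))
    t : Fin m → Carrier
    t l = - 1# * proj₁ (coords l) zero
    w = shear y t v
    yw-ind : LinIndep (y ∷ w)
    yw-ind = shear-indep y v t (proj₂ (proj₂ basis))
    w∈M : ∀ l → M (w l)
    w∈M l = +-cl M-sub (v∈M l) (·-cl M-sub (t l) (b∈ j))
    w∈N : ∀ l → N (w l)
    w∈N l = resp N-sub w≈ (lincomb-∈ N-sub (tail c) d∈)
      where
      c = proj₁ (coords l)
      w≈ : lincomb (tail c) d ≈ᵥ w l
      w≈ i = sym (begin
        v l i ⊕ (- 1# * c zero) * y i            ≈⟨ +-cong (trans (proj₂ (coords l) i) (+-comm _ _)) (*-assoc _ _ _) ⟩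
        (lincomb (tail c) d i ⊕ c zero * y i) ⊕ - 1# * (c zero * y i)  ≈⟨ [x+y]+-1*y≈x _ _ ⟩
        lincomb (tail c) d i                      ∎)
    spans : Spans w (M ∩ N)
    spans x (x∈M , x∈N) =
      let c , x≈ = indep-spans (proj₂ M-dim) M-sub (y ∷ w) yw-ind
                     (λ { zero → b∈ j ; (suc l) → w∈M l }) x x∈M
          -- Both `x` and its part along `w` lie in `N`, while `y` does not.
          c₀≈0 = ·-cancel-∈ N-sub y∉N (lincomb-∈ N-sub (tail c) w∈N) (resp N-sub x≈ x∈N)
      in tail c , λ i → trans (x≈ i) (trans (+-congʳ (trans (*-congʳ c₀≈0) (zeroˡ _))) (+-identityˡ _))

  -- Supplies the bottom space of a line when the clique has no members and any such space will do.
  codim-2 : Subspace (suc (suc m)) U → Σ SubsetV λ S → Subspace m S × S ⊆ U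
  codim-2 (U-sub , b , b∈ , b-ind , _) = Span (tail (tail b)) ,
    span-Subspace _ (indep-tail (tail b) (indep-tail b b-ind)) , span-⊆ _ U-sub (λ i → b∈ (suc (suc i)))

  -- By `indep-spans`, a basis of `M` already spans `N`.
  ⊆-antisym-dim : Subspace m M → Subspace m N → M ⊆ N → N ⊆ M
  ⊆-antisym-dim (M-sub , b , b∈ , b-ind , _) (N-sub , N-dim) M⊆N =
    spans-⊆ b (indep-spans N-dim N-sub b b-ind (λ i → M⊆N _ (b∈ i))) M-sub b∈

  -- Distinct hyperplanes of `U` meet in codimension two; equality of dimensions turns distinctness
  -- into the non-inclusion that `meet-dim` asks for. Only maximality is then at stake.
  CodesIn-isClique : ∀ {k} → Subspace (suc (suc k)) U → IsClique (suc k) (CodesIn (suc k) U)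
  CodesIn-isClique U-dim = (λ S S∈ → proj₂ (lower S∈)) ,
    λ { M N (lift (M⊆U , M-dim , _)) (lift (N⊆U , N-dim , _)) M≉N → M≉N ,
        meet-dim U-dim M-dim N-dim M⊆U N⊆U
          λ M⊆N → M≉N (M⊆N , ⊆-antisym-dim M-dim N-dim M⊆N) }

  -- Unit vectors.

  unit : Fin n → V
  unit j i with i ≟ j
  ... | yes _ = 1#
  ... | no  _ = 0#

  unit-≡ : ∀ j → unit j j ≈ 1#
  unit-≡ j with j ≟ j
  ... | yes _   = refl
  ... | no  j≢j = contradiction ≡.refl j≢j

  unit-≢ : ∀ {i j} → i ≢ j → unit j i ≈ 0#
  unit-≢ {i} {j} i≢j with i ≟ j
  ... | yes i≡j = contradiction i≡j i≢j
  ... | no  _   = refl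

  -- Codes in `U` sharing a nonzero vector `y`: finding a vector outside `U`.

  module CommonVector {k} {U : SubsetV} (U-dim : Subspace (suc (suc (suc k))) U)
    (U-nondeg : NonDegenerate U) {y : V} (y∈U : U y) (y≉0 : ¬ (y ≈ᵥ 0ᵥ))
    (common : ∀ K → CodesIn (suc (suc k)) U K → K y) where

    private
      U-sub = proj₁ U-dim
      basis = exchange U-dim y∈U y≉0
      v = proj₁ basis
      v∈U = proj₁ (proj₂ basis)
      yv-ind : LinIndep (y ∷ v)
      yv-ind = proj₂ (proj₂ basis)

    -- The hyperplane of U spanned by shear y t v misses y, so it is degenerate.
    degenerate-at : (t : Fin (suc (suc k)) → Carrier) →
      Σ (Fin n) λ i → ¬ (y i ≈ 0#) × (∀ j → shear y t v j i ≈ 0#)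
    degenerate-at t with any? (λ i → all? λ j → shear y t v j i ≈? 0#)
    ... | yes (i , w∈Cᵢ) = i , yᵢ≉0 , w∈Cᵢ
      where
      -- Otherwise `y` and the sheared vectors, a basis of `U`, would all lie in `C i`.
      yᵢ≉0 : ¬ (y i ≈ 0#)
      yᵢ≉0 yᵢ≈0 = U-nondeg i (spans-⊆ (y ∷ shear y t v)
        (indep-spans (proj₂ U-dim) U-sub (y ∷ shear y t v) (shear-indep y v t yv-ind)
          λ { zero → y∈U ; (suc j) → +-cl U-sub (v∈U j) (·-cl U-sub (t j) y∈U) })
        (C-subspace i) λ { zero → yᵢ≈0 ; (suc j) → w∈Cᵢ j })
    ... | no nowhere = contradiction (common K (lift (K⊆U , span-Subspace w (indep-tail (y ∷ w) yw-ind) , K-nondeg)))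
                         (indep-head∉span-tail (y ∷ w) yw-ind)
      where
      w = shear y t v
      K = Span w
      yw-ind : LinIndep (y ∷ w)
      yw-ind = shear-indep y v t yv-ind
      K⊆U : K ⊆ U
      K⊆U = span-⊆ w U-sub λ j → +-cl U-sub (v∈U j) (·-cl U-sub (t j) y∈U)
      K-nondeg : NonDegenerate K
      K-nondeg i K⊆Cᵢ = nowhere (i , λ j → K⊆Cᵢ (w j) (∈-span w j))

    private
      -- Selects the kernel of y* - s v₀* - r v₁*. This takes two vectors in `v`, supplied by
      -- `1 < k`.
      t⟨_,_⟩ : Carrier → Carrier → Fin (suc (suc k)) → Carrier
      t⟨ s , r ⟩ = s ∷ r ∷ λ _ → 0#

    -- At such an `i` the first two entries of `v` are `- s * y i` and `- r * y i`, and the others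
    -- are zero. The identity avoids subtraction so that the semiring solver applies.
    lincomb-at : ∀ {i} (s r : Carrier) (c : Fin (suc (suc (suc k))) → Carrier) →
      (∀ j → shear y t⟨ s , r ⟩ v j i ≈ 0#) →
      lincomb c (y ∷ v) i ⊕ (c (suc zero) * s ⊕ c (suc (suc zero)) * r) * y i ≈ c zero * y i
    lincomb-at {i} s r c w≈0 = begin
      (c zero * y i ⊕ (c₁ * v zero i ⊕ (c₂ * v (suc zero) i ⊕ rest))) ⊕ (c₁ * s ⊕ c₂ * r) * y i
        ≈⟨ solve 9 (λ c₀ c₁ c₂ y v₀ v₁ l s r →
             (c₀ :* y :+ (c₁ :* v₀ :+ (c₂ :* v₁ :+ l))) :+ (c₁ :* s :+ c₂ :* r) :* y
             := c₀ :* y :+ (c₁ :* (v₀ :+ s :* y) :+ (c₂ :* (v₁ :+ r :* y) :+ l)))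
             refl (c zero) c₁ c₂ (y i) (v zero i) (v (suc zero) i) rest s r ⟩
      c zero * y i ⊕ lincomb (tail c) v′ i
        ≈⟨ +-congˡ (lincomb-∈ (C-subspace i) (tail c) {v′} λ
             { zero          → w≈0 zero
             ; (suc zero)    → w≈0 (suc zero)
             ; (suc (suc j)) → trans (sym (trans (+-congˡ (zeroˡ _)) (+-identityʳ _))) (w≈0 (suc (suc j))) }) ⟩
      c zero * y i ⊕ 0#
        ≈⟨ +-identityʳ _ ⟩
      c zero * y i ∎
      where
      c₁ = c (suc zero)
      c₂ = c (suc (suc zero))
      v′ : Fin (suc (suc k)) → V
      v′ = shear y t⟨ s , r ⟩ v zero ∷ shear y t⟨ s , r ⟩ v (suc zero) ∷ tail (tail v)
      rest = lincomb (tail (tail (tail c))) (tail (tail v)) i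

    pivot : Fin n
    pivot = proj₁ (degenerate-at t⟨ 0# , 0# ⟩)

    y-pivot≉0 : ¬ (y pivot ≈ 0#)
    y-pivot≉0 = proj₁ (proj₂ (degenerate-at t⟨ 0# , 0# ⟩))

    shear-pivot : ∀ j → shear y t⟨ 0# , 0# ⟩ v j pivot ≈ 0#
    shear-pivot = proj₂ (proj₂ (degenerate-at t⟨ 0# , 0# ⟩))

    private
      shear-zero : ∀ {x t z : Carrier} → t ≈ 0# → x ⊕ t * z ≈ 0# → x ≈ 0#
      shear-zero t≈0 eq = trans (sym (trans (+-congˡ (trans (*-congʳ t≈0) (zeroˡ _))) (+-identityʳ _))) eq

      shear-one : ∀ {x z : Carrier} → x ≈ 0# → x ⊕ 1# * z ≈ 0# → z ≈ 0#
      shear-one x≈0 eq = trans (sym (trans (+-cong x≈0 (*-identityˡ _)) (+-identityˡ _))) eq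

    -- Every `v j` vanishes at `pivot`, so a vector `v j` sheared with coefficient one takes the
    -- nonzero value `y pivot` there.
    ≢pivot : ∀ {i} s r j → t⟨ 0# , 0# ⟩ j ≈ 0# → t⟨ s , r ⟩ j ≡ 1# →
      shear y t⟨ s , r ⟩ v j i ≈ 0# → i ≢ pivot
    ≢pivot s r j t₀≈0 t≡1 w≈0 ≡.refl = y-pivot≉0 (shear-one
      (shear-zero t₀≈0 (shear-pivot j))
      (≡.subst (λ z → v j pivot ⊕ z * y pivot ≈ 0#) t≡1 w≈0))

    -- If unit pivot = c₀ y + c₁ v₀ + c₂ v₁ + …, the hyperplanes with
    -- (s , r) = (1 , 0), (0 , 1), (1 , 1) give c₀ = c₁ = c₂ = c₁ + c₂, hence
    -- c₀ = 0, while (0 , 0) gives c₀ * y pivot = 1.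
    unit-pivot∉U : ¬ U (unit pivot)
    unit-pivot∉U e∈U = 1≉0 (begin
      1#                                                   ≈⟨ unit-≡ pivot ⟨
      unit pivot pivot                                     ≈⟨ e≈ pivot ⟩
      lincomb c (y ∷ v) pivot                              ≈⟨ +-identityʳ _ ⟨
      lincomb c (y ∷ v) pivot ⊕ 0#                         ≈⟨ +-congˡ (trans (*-congʳ c·0≈0) (zeroˡ _)) ⟨
      lincomb c (y ∷ v) pivot ⊕ (c₁ * 0# ⊕ c₂ * 0#) * y pivot  ≈⟨ lincomb-at 0# 0# c shear-pivot ⟩
      c zero * y pivot                                     ≈⟨ *-congʳ c₀≈0 ⟩
      0# * y pivot                                         ≈⟨ zeroˡ _ ⟩
      0#                                                   ∎)
      where
      coords : Span (y ∷ v) (unit pivot)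
      coords = indep-spans (proj₂ U-dim) U-sub (y ∷ v) yv-ind
        (λ { zero → y∈U ; (suc j) → v∈U j }) (unit pivot) e∈U
      c = proj₁ coords
      e≈ = proj₂ coords
      c₁ = c (suc zero)
      c₂ = c (suc (suc zero))
      c·0≈0 : c₁ * 0# ⊕ c₂ * 0# ≈ 0#
      c·0≈0 = trans (+-cong (zeroʳ c₁) (zeroʳ c₂)) (+-identityˡ 0#)
      -- The degenerate index `i` differs from `pivot`, so `unit pivot` vanishes there; `lincomb-at`
      -- then leaves an equation from which `y i` cancels.
      relation : ∀ s r j → t⟨ 0# , 0# ⟩ j ≈ 0# → t⟨ s , r ⟩ j ≡ 1# → c₁ * s ⊕ c₂ * r ≈ c zero
      relation s r j t₀≈0 t≡1 =
        let i , yᵢ≉0 , w≈0 = degenerate-at t⟨ s , r ⟩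
            eᵢ≈0 = unit-≢ (≢pivot s r j t₀≈0 t≡1 (w≈0 j))
        in *-cancelʳ yᵢ≉0 (trans
          (sym (trans (+-congʳ (trans (sym (e≈ i)) eᵢ≈0)) (+-identityˡ _)))
          (lincomb-at s r c w≈0))
      c₁≈c₀ : c₁ ≈ c zero
      c₁≈c₀ = trans (sym (trans (+-cong (*-identityʳ c₁) (zeroʳ c₂)) (+-identityʳ c₁)))
        (relation 1# 0# zero refl ≡.refl)
      c₂≈c₀ : c₂ ≈ c zero
      c₂≈c₀ = trans (sym (trans (+-cong (zeroʳ c₁) (*-identityʳ c₂)) (+-identityˡ c₂)))
        (relation 0# 1# (suc zero) refl ≡.refl)
      c₁+c₂≈c₀ : c₁ ⊕ c₂ ≈ c zero
      c₁+c₂≈c₀ = trans (sym (+-cong (*-identityʳ c₁) (*-identityʳ c₂)))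
        (relation 1# 1# zero refl ≡.refl)
      c₀≈0 : c zero ≈ 0#
      c₀≈0 = begin
        c zero                     ≈⟨ xyx⁻¹≈y (c zero) (c zero) ⟨
        (c zero ⊕ c zero) - c zero ≈⟨ +-congʳ (trans (+-cong (sym c₁≈c₀) (sym c₂≈c₀)) c₁+c₂≈c₀) ⟩
        c zero - c zero            ≈⟨ -‿inverseʳ (c zero) ⟩
        0#                         ∎

    -- With no common zero coordinate, `x` and `y` together make any subspace containing both
    -- non-degenerate.
    outside : Σ V λ x → ¬ U x × (∀ i → x i ≈ 0# → ¬ (y i ≈ 0#))
    outside with member? U-dim (λ _ → 1#)
    ... | no  1∉U = (λ _ → 1#) , 1∉U , λ _ 1≈0 → contradiction 1≈0 1≉0
    ... | yes 1∈U = x , x∉U , x-y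
      where
      x : V
      -- The entry at `pivot` is 1 + 1, which is zero in characteristic 2; `y pivot` is nonzero to
      -- cover this case.
      x = unit pivot +ᵥ λ _ → 1#
      x∉U : ¬ U x
      x∉U x∈U = unit-pivot∉U (resp U-sub (λ i → [x+y]+-1*y≈x _ _)
        (+-cl U-sub x∈U (·-cl U-sub (- 1#) 1∈U)))
      x-y : ∀ i → x i ≈ 0# → ¬ (y i ≈ 0#)
      x-y i xᵢ≈0 yᵢ≈0 = 1≉0 (trans
        (sym (trans (+-congʳ (unit-≢ i≢pivot)) (+-identityˡ 1#))) xᵢ≈0)
        where
        i≢pivot : i ≢ pivot
        i≢pivot i≡pivot = y-pivot≉0 (≡.subst (λ j → y j ≈ 0#) i≡pivot yᵢ≈0)

  -- The two implications.

  common-subspace⇒¬maximal : ∀ {k} → Subspace (suc (suc (suc k))) U → NonDegenerate U →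
    Subspace (suc k) S → S ⊆ U → (∀ K → CodesIn (suc (suc k)) U K → S ⊆ K) →
    ¬ IsMaximalClique (suc (suc k)) (CodesIn (suc (suc k)) U)
  common-subspace⇒¬maximal {U} {S} {k} U-dim@(U-sub , _) U-nondeg
    (_ , s , s∈ , s-ind , _) S⊆U common (clique , maximal)
    = x∉U (proj₁ (lower (maximal 𝒟 𝒟-clique (λ _ → inj₁) K (inj₂ ≡.refl))) x (∈-span (x ∷ s) zero))
    where
    -- `S` has dimension `suc k`, positive because `1 < k` in the theorem.
    y = s zero
    y≉0 : ¬ (y ≈ᵥ 0ᵥ)
    y≉0 y≈0 = indep-head∉span-tail s s-ind
      (resp (span-subspace (tail s)) (λ i → sym (y≈0 i)) (zero∈ (span-subspace (tail s))))
    open CommonVector U-dim U-nondeg (S⊆U y (s∈ zero)) y≉0 (λ K K∈ → common K K∈ y (s∈ zero))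
    x = proj₁ outside
    x∉U = proj₁ (proj₂ outside)
    s∈U : ∀ i → U (s i)
    s∈U i = S⊆U (s i) (s∈ i)
    K = Span (x ∷ s)
    K-vertex : Vertex (suc (suc k)) K
    K-vertex = span-Subspace (x ∷ s) (indep-∷ x s (λ x∈ → x∉U (span-⊆ s U-sub s∈U x x∈)) s-ind) ,
      λ i K⊆Cᵢ → proj₂ (proj₂ outside) i (K⊆Cᵢ x (∈-span (x ∷ s) zero))
                   (K⊆Cᵢ y (∈-span (x ∷ s) (suc zero)))
    s∈K : ∀ i → K (s i)
    s∈K i = ∈-span (x ∷ s) (suc i)
    span-meet : ∀ M → CodesIn (suc (suc k)) U M → ∀ z → M z → K z → Span s z
    span-meet M (lift (M⊆U , _)) z z∈M (c , z≈) = tail c , λ i → trans (z≈ i)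
      (trans (+-congʳ (trans (*-congʳ c₀≈0) (zeroˡ _))) (+-identityˡ _))
      where
      c₀≈0 : c zero ≈ 0#
      c₀≈0 = ·-cancel-∈ U-sub x∉U (lincomb-∈ U-sub (tail c) s∈U) (resp U-sub z≈ (M⊆U z z∈M))
    𝒟 : Family
    -- The new vertex is added up to `≡`, so that cases are settled by matching on `≡.refl`.
    𝒟 X = CodesIn (suc (suc k)) U X ⊎ X ≡ K
    𝒟-clique : IsClique (suc (suc k)) 𝒟
    proj₁ 𝒟-clique M (inj₁ M∈)     = proj₁ clique M M∈
    proj₁ 𝒟-clique _ (inj₂ ≡.refl) = K-vertex
    proj₂ 𝒟-clique M N (inj₁ M∈) (inj₁ N∈) M≉N = proj₂ clique M N M∈ N∈ M≉N
    proj₂ 𝒟-clique M _ (inj₁ M∈) (inj₂ ≡.refl) M≉K = M≉K ,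
      s , (λ i → common M M∈ (s i) (s∈ i) , s∈K i) , s-ind ,
      λ z (z∈M , z∈K) → span-meet M M∈ z z∈M z∈K
    proj₂ 𝒟-clique _ M (inj₂ ≡.refl) (inj₁ M∈) K≉M = K≉M ,
      s , (λ i → s∈K i , common M M∈ (s i) (s∈ i)) , s-ind ,
      λ z (z∈K , z∈M) → span-meet M M∈ z z∈M z∈K
    proj₂ 𝒟-clique _ _ (inj₂ ≡.refl) (inj₂ ≡.refl) K≉K =
      contradiction ((λ _ z∈ → z∈) , λ _ z∈ → z∈) K≉K

  -- The bottom `S` of the line lies in `U` as soon as one member exists. If it does not, there are
  -- no members, and a subspace from `codim-2` is vacuously common to all.
  maximal⇒¬line : ∀ {k} → Subspace (suc (suc (suc k))) U → NonDegenerate U →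
    IsMaximalClique (suc (suc k)) (CodesIn (suc (suc k)) U) →
    ¬ ContainedInLine (suc (suc k)) (CodesIn (suc (suc k)) U)
  maximal⇒¬line {U} U-dim@(U-sub , _) U-nondeg maximal
    (S , T , S-dim@(_ , s , s∈ , _ , s-span) , _ , _ , in-line)
    with all? (λ j → member? U-dim (s j))
  ... | yes s∈U = common-subspace⇒¬maximal U-dim U-nondeg S-dim (spans-⊆ s s-span U-sub s∈U)
                    (λ K K∈ → proj₁ (proj₂ (in-line K K∈))) maximal
  ... | no  s∉U = let S′ , S′-dim , S′⊆U = codim-2 U-dim in
    common-subspace⇒¬maximal U-dim U-nondeg S′-dim S′⊆U
      (λ K K∈ → contradiction
        (λ j → proj₁ (lower K∈) (s j) (proj₁ (proj₂ (in-line K K∈)) (s j) (s∈ j))) s∉U)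
      maximal

  ¬line⇒maximal : ∀ {k} → Subspace (suc (suc k)) U →
    ¬ ContainedInLine (suc k) (CodesIn (suc k) U) → IsMaximalClique (suc k) (CodesIn (suc k) U)
  ¬line⇒maximal {U} {k} U-dim@(U-sub , _) ¬line = CodesIn-isClique U-dim ,
    λ 𝒟 𝒟-clique ⊆𝒟 K K∈ → let K-dim , K-nondeg = proj₁ 𝒟-clique K K∈ in
      lift (inside 𝒟 𝒟-clique ⊆𝒟 K K∈ K-dim , K-dim , K-nondeg)
    where
    module _ (𝒟 : Family) (𝒟-clique : IsClique (suc k) 𝒟) (⊆𝒟 : ∀ S → CodesIn (suc k) U S → 𝒟 S)
      (K : SubsetV) (K∈ : 𝒟 K) (K-dim : Subspace (suc k) K) where
      K-sub = proj₁ K-dim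
      module _ (K⊈U : ¬ K ⊆ U) where
        meets : ∀ M → CodesIn (suc k) U M → HasDim (M ∩ K) k
        meets M M∈ = proj₂ (proj₂ 𝒟-clique M K (⊆𝒟 M M∈) K∈
          λ (_ , K⊆M) → K⊈U λ x x∈ → proj₁ (lower M∈) x (K⊆M x x∈))
        -- A vector of M ∩ K outside N would, together with N ∩ K, span K inside U.
        same-meet : ∀ M N → CodesIn (suc k) U M → CodesIn (suc k) U N → (M ∩ K) ⊆ N
        same-meet M N (lift (M⊆U , _)) N∈@(lift (N⊆U , N-dim , _)) x (x∈M , x∈K)
          with member? N-dim x | meets N N∈
        ... | yes x∈N | _ = x∈N
        ... | no  x∉N | b , b∈ , b-ind , _ = contradiction
          (spans-⊆ (x ∷ b) (indep-spans (proj₂ K-dim) K-sub (x ∷ b)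
              (indep-∷ x b (λ x∈ → x∉N (span-⊆ b (proj₁ N-dim) (λ i → proj₁ (b∈ i)) x x∈)) b-ind)
              λ { zero → x∈K ; (suc i) → proj₂ (b∈ i) })
            U-sub λ { zero → M⊆U x x∈M ; (suc i) → N⊆U (b i) (proj₁ (b∈ i)) })
          K⊈U
        -- A single member `M` suffices: `M ∩ K` lies in every member, so it and `U` bound a line
        -- containing all of them.
        empty : ∀ M → ¬ CodesIn (suc k) U M
        empty M M∈@(lift (M⊆U , (M-sub , _) , _)) = ¬line (M ∩ K , U ,
          (∩-subspace M-sub K-sub , meets M M∈) , U-dim , (λ x (x∈M , _) → M⊆U x x∈M) ,
          λ N N∈ → proj₁ (proj₂ (lower N∈)) , same-meet M N M∈ N∈ , proj₁ (lower N∈))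
        -- Without members, every line contains the clique.
        absurd : ⊥
        absurd = let S , S-dim , S⊆U = codim-2 U-dim in
          ¬line (S , U , S-dim , U-dim , S⊆U , λ N N∈ → contradiction N∈ (empty N))
      inside : K ⊆ U
      inside x x∈ = decidable-stable (member? U-dim x) λ x∉U → absurd λ K⊆U → x∉U (K⊆U x x∈)

theorem2 : ∀ {q : ℕ} (F : FiniteField q) → IsPrimePower q →
    ∀ (n k : ℕ) → 1 < k → k + 1 < n →
    let open Codes F n in
    ∀ (U : SubsetV) → Subspace (suc k) U → NonDegenerate U →
    (IsMaximalClique k (CodesIn k U) ⇔ (¬ ContainedInLine k (CodesIn k U)))
theorem2 F _ n (suc (suc k)) (s≤s (s≤s z≤n)) _ U U-dim U-nondeg =
  mk⇔ (maximal⇒¬line U-dim U-nondeg) (¬line⇒maximal U-dim)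
  where open LinearAlgebra F n
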